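{- Let $C=L_1;\ldots;L_d$ be a sorting network on $n$ channels of depth $d$ that contains no redundant comparators. Then for every $k$ with $1\le k<d$ and every comparator $(i,j)\in L_k$, the comparator $(i,j)$ connects adjacent $k$-blocks of $C$; that is, every channel $m$ with $i<m<j$ belongs either to the $k$-block containing $i$ or to the $k$-block containing $j$.
   Context: Channels are numbered $1,\ldots,n$. A comparator network on $n$ channels of depth $d$ is a sequence $C=L_1;\ldots;L_d$ of layers; each layer is a set of comparators $(i,j)$ with $1\le i<j\le n$, and each channel occurs in at most one comparator of a given layer. An input $\bar x\in\{0,1\}^n$ propagates through $C$ as follows: $\bar x_0=\bar x$, and for $0<k\le d$, $\bar x_k$ is obtained from $\bar x_{k-1}$ by, for each comparator $(i,j)\in L_k$, putting the minimum of the values at positions $i,j$ of $\bar x_{k-1}$ at position $i$ and the maximum at position $j$ (other positions unchanged). The output is $C(\bar x)=\bar x_d$. $C$ is a sorting network if $C(\bar x)$ is sorted in non-decreasing order for every $\bar x\in\{0,1\}^n$. A comparator $(i,j)$ in layer $L_\ell$ is redundant if for every input $\bar x\in\{0,1\}^n$ the entries of $\bar x_{\ell-1}$ at positions $i$ and $j$ satisfy $(\bar x_{\ell-1})_i\le(\bar x_{\ell-1})_j$. For $0\le k<d$, the $k$-blocks of $C$ are the vertex sets of the connected components of the graph on the channels $\{1,\ldots,n\}$ having an edge $\{i,j\}$ for every comparator $(i,j)$ occurring in some layer $L_{k'}$ with $k'>k$; thus the $k$-blocks partition the set of channels. -}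

module Defs where

open import Data.Bool.Base as Bool using (Bool; _∧_; _∨_; if_then_else_)
open import Data.Fin.Base as Fin using (Fin; toℕ)
open import Data.Fin.Properties using (_≟_)
open import Data.List.Base using (List; []; _∷_)
open import Data.List.Membership.Propositional using (_∈_)
open import Data.List.Relation.Unary.AllPairs using (AllPairs)
open import Data.Nat.Base as ℕ using (ℕ; zero; suc; pred)
open import Data.Product.Base using (∃; _×_)
open import Data.Sum.Base using (_⊎_)
open import Data.Vec.Base using (Vec; []; _∷_; lookup)
open import Data.Vec.Functional using (Vector)
open import Level using (0ℓ)
open import Relation.Binary.Construct.Closure.Equivalence using (EqClosure)
open import Relation.Binary.Core using (Rel; _Preserves_⟶_)
open import Relation.Binary.PropositionalEquality.Core using (_≡_)
open import Relation.Nullary.Decidable.Core using (⌊_⌋)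
open import Relation.Nullary.Negation.Core using (¬_)
open import Relation.Unary using (Pred)

private
  variable
    n d : ℕ

record Comparator (n : ℕ) : Set where
  field
    lo hi : Fin n
    lo<hi : lo Fin.< hi

open Comparator public

Touches : Comparator n → Pred (Fin n) 0ℓ
Touches c p = p ≡ lo c ⊎ p ≡ hi c

Disjoint : Rel (Comparator n) 0ℓ
Disjoint c c′ = ∀ p → ¬ (Touches c p × Touches c′ p)

-- A set of comparators as a duplicate-free list: pairwise disjointness
-- also rules out repeated entries.
record Layer (n : ℕ) : Set where
  field
    comparators : List (Comparator n)
    disjoint    : AllPairs Disjoint comparators

open Layer public

Network : ℕ → ℕ → Set
Network n d = Vec (Layer n) d

-- On {0,1}, with false = 0 and true = 1, _∧_ is the minimum and _∨_ the
-- maximum.  Every comparator reads the values x from before the layer.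
applyComparators : List (Comparator n) → Vector Bool n → Vector Bool n
applyComparators []       x p = x p
applyComparators (c ∷ cs) x p =
  if ⌊ p ≟ lo c ⌋ then x (lo c) ∧ x (hi c)
  else if ⌊ p ≟ hi c ⌋ then x (lo c) ∨ x (hi c)
  else applyComparators cs x p

applyLayer : Layer n → Vector Bool n → Vector Bool n
applyLayer L = applyComparators (comparators L)

-- The values after the first k layers; only k ≤ d is meaningful.
after : Network n d → ℕ → Vector Bool n → Vector Bool n
after C       zero    x = x
after []      (suc k) x = x
after (L ∷ C) (suc k) x = after C k (applyLayer L x)

output : Network n d → Vector Bool n → Vector Bool n
output {d = d} C = after C d

IsSorted : Pred (Vector Bool n) 0ℓ
IsSorted y = y Preserves Fin._≤_ ⟶ Bool._≤_

IsSortingNetwork : Pred (Network n d) 0ℓ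
IsSortingNetwork C = ∀ x → IsSorted (output C x)

-- Layers are numbered from 1, so the k-th layer is at position k - 1.
InLayer : Network n d → ℕ → Pred (Comparator n) 0ℓ
InLayer C k c = ∃ λ ℓ → suc (toℕ ℓ) ≡ k × c ∈ comparators (lookup C ℓ)

Redundant : Network n d → ℕ → Pred (Comparator n) 0ℓ
Redundant C k c =
  ∀ x → after C (pred k) x (lo c) Bool.≤ after C (pred k) x (hi c)

NoRedundantComparators : Pred (Network n d) 0ℓ
NoRedundantComparators C = ∀ k c → InLayer C k c → ¬ Redundant C k c

Edge : Network n d → ℕ → Rel (Fin n) 0ℓ
Edge C k a b =
  ∃ λ k′ → k ℕ.< k′ × ∃ λ c → InLayer C k′ c × a ≡ lo c × b ≡ hi c

-- The k-block containing a given channel.  Edges are oriented from the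
-- lower to the upper channel; EqClosure makes them undirected.
Block : Network n d → ℕ → Fin n → Pred (Fin n) 0ℓ
Block C k = EqClosure (Edge C k)

ConnectsAdjacentBlocks : Network n d → ℕ → Pred (Comparator n) 0ℓ
ConnectsAdjacentBlocks C k c =
  ∀ m → lo c Fin.< m → m Fin.< hi c → Block C k (lo c) m ⊎ Block C k (hi c) m

{-# OPTIONS --safe #-}

-- Suppose (i,j) lies in layer k, i < m < j, and neither i nor j is in the
-- k-block B of m.  Let f x be the state after layer k with (i,j) left out,
-- and let w be the number of channels above m.  Layers after k preserve the
-- number of ones outside B, and so does (i,j), hence f x has as many ones
-- outside B as the sorted output of x.  When x of weight w grows by one bit,
-- the output changes at m only, so by monotonicity f x does not change outside
-- B.  Inputs of weight w are linked by such steps up and down, so on them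
-- f agrees outside B with its value on the sorted input, which comparators
-- fix: 0 at i and 1 at j.  Every input is comparable with one of weight w,
-- so monotonicity gives f x i ≤ f x j for all x, and (i,j) is redundant.
module Submission where

open import Defs
open import Data.Bool.Base as Bool using (Bool; true; false; not; _∧_; _∨_; if_then_else_; b≤b; f≤t)
import Data.Bool.Properties as Bool
open import Data.Fin.Base as Fin using (Fin; zero; suc; toℕ)
import Data.Fin.Properties as Fin
open import Data.Fin.Permutation using (transpose; _⟨$⟩ʳ_)
open import Data.List.Base using (List; []; _∷_; _++_)
open import Data.List.Membership.Propositional using (_∈_)
open import Data.List.Membership.Propositional.Properties using (∈-++⁺ˡ; ∈-++⁺ʳ; ∈-++⁻)
open import Data.List.Relation.Unary.All as All using (All; []; _∷_)
open import Data.List.Relation.Unary.AllPairs using (AllPairs; []; _∷_)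
open import Data.List.Relation.Unary.Any using (here; there)
open import Data.Nat.Base using (ℕ; zero; suc; _≤_; _<_; z≤n; s≤s; s≤s⁻¹)
open import Data.Nat.Properties as ℕ using (+-0-commutativeMonoid)
open import Data.Product.Base using (∃; _×_; _,_)
open import Data.Sum.Base using (_⊎_; inj₁; inj₂)
open import Data.Vec.Base using (Vec; []; _∷_; lookup; replicate; tabulate)
open import Data.Vec.Functional using (Vector)
open import Data.Vec.Properties using (lookup-replicate; lookup∘tabulate)
open import Function.Base using (_∘_)
open import Level using (0ℓ)
open import Relation.Binary.Construct.Closure.Equivalence using (EqClosure; return; symmetric)
open import Relation.Binary.Construct.Closure.ReflexiveTransitive using (ε; _◅◅_)
open import Relation.Binary.Core using (Rel)
open import Relation.Binary.PropositionalEquality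
  using (_≡_; _≢_; _≗_; refl; sym; trans; cong; cong₂; subst; subst₂; module ≡-Reasoning)
open import Relation.Nullary.Decidable using (Dec; ⌊_⌋; yes; no)
open import Relation.Nullary.Negation using (¬_; contradiction)
open import Algebra.Properties.CommutativeMonoid.Sum +-0-commutativeMonoid
  using (sum; sum-cong-≗; sum-permute)

private
  variable
    n d : ℕ

-- Pointwise order, weight and covers of 0/1 vectors

infix 4 _⊑_ _⋖_
infixr 7 _⊓_

_⊑_ : Rel (Vector Bool n) 0ℓ
x ⊑ y = ∀ p → x p Bool.≤ y p

-- With `χ` the indicator of a set of channels, `weight (χ ⊓ x)` counts the ones of `x` inside that
-- set.
_⊓_ : Vector Bool n → Vector Bool n → Vector Bool n
(χ ⊓ x) p = χ p ∧ x p

⊓-monoʳ-⊑ : ∀ (χ : Vector Bool n) {x y} → x ⊑ y → χ ⊓ x ⊑ χ ⊓ y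
⊓-monoʳ-⊑ χ x⊑y p with χ p
... | true  = x⊑y p
... | false = b≤b

bit : Bool → ℕ
bit false = 0
bit true  = 1

weight : Vector Bool n → ℕ
weight x = sum (bit ∘ x)

weight-cong : {x y : Vector Bool n} → x ≗ y → weight x ≡ weight y
weight-cong x≗y = sum-cong-≗ (cong bit ∘ x≗y)

bit-mono : ∀ {a b} → a Bool.≤ b → bit a ≤ bit b
bit-mono f≤t = z≤n
bit-mono b≤b = ℕ.≤-refl

weight-mono : ∀ {n} {x y : Vector Bool n} → x ⊑ y → weight x ≤ weight y
weight-mono {zero}  x⊑y = z≤n
weight-mono {suc n} x⊑y = ℕ.+-mono-≤ (bit-mono (x⊑y zero)) (weight-mono (x⊑y ∘ suc))

-- A position where `x` is strictly below `y` would make `weight y` strictly larger. This turns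
-- preserved counts into pointwise equality.
⊑∧weight≥⇒≗ : ∀ {n} {x y : Vector Bool n} → x ⊑ y → weight y ≤ weight x → x ≗ y
⊑∧weight≥⇒≗ {suc n} {x} {y} x⊑y ≥ p with x zero in x₀ | y zero in y₀ | x⊑y zero
... | _ | _ | f≤t = contradiction (ℕ.≤-trans ≥ (weight-mono (x⊑y ∘ suc))) ℕ.1+n≰n
⊑∧weight≥⇒≗ {suc n} x⊑y ≥ zero    | _ | _ | b≤b = trans x₀ (sym y₀)
⊑∧weight≥⇒≗ {suc n} x⊑y ≥ (suc p) | b | _ | b≤b =
  ⊑∧weight≥⇒≗ (x⊑y ∘ suc) (ℕ.+-cancelˡ-≤ (bit b) _ _ ≥) p

-- The covering relation of the Boolean lattice. It lives on `Vec` because an arbitrary function on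
-- `Vector` cannot be assumed to respect pointwise equality.
data _⋖_ : ∀ {n} → Rel (Vec Bool n) 0ℓ where
  raise : {v : Vec Bool n} → false ∷ v ⋖ true ∷ v
  keep  : ∀ {b} {u v : Vec Bool n} → u ⋖ v → b ∷ u ⋖ b ∷ v

⋖⇒⊑ : {u v : Vec Bool n} → u ⋖ v → lookup u ⊑ lookup v
⋖⇒⊑ raise      zero    = f≤t
⋖⇒⊑ raise      (suc p) = b≤b
⋖⇒⊑ (keep u⋖v) zero    = b≤b
⋖⇒⊑ (keep u⋖v) (suc p) = ⋖⇒⊑ u⋖v p

⋖-weight : {u v : Vec Bool n} → u ⋖ v → weight (lookup v) ≡ suc (weight (lookup u))
⋖-weight raise                  = refl
⋖-weight (keep {b = false} u⋖v) = ⋖-weight u⋖v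
⋖-weight (keep {b = true}  u⋖v) = cong suc (⋖-weight u⋖v)

∃-⋖ : ∀ {n w} (v : Vec Bool n) → weight (lookup v) ≡ suc w →
      ∃ λ u → u ⋖ v × weight (lookup u) ≡ w
∃-⋖ (true  ∷ v) eq = false ∷ v , raise , ℕ.suc-injective eq
∃-⋖ (false ∷ v) eq with u , u⋖v , eq′ ← ∃-⋖ v eq = false ∷ u , keep u⋖v , eq′

-- Two vectors of equal weight are joined by a zigzag that alternately raises one bit and lowers
-- another, so only steps from this weight to the next matter.
⋖-invariant⇒constant :
  ∀ {n} {A : Set} (f : Vec Bool n → A) (u v : Vec Bool n) →
  weight (lookup u) ≡ weight (lookup v) →
  (∀ {a b} → weight (lookup a) ≡ weight (lookup u) → a ⋖ b → f a ≡ f b) →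
  f u ≡ f v
⋖-invariant⇒constant f []          []          eq inv = refl
⋖-invariant⇒constant f (false ∷ u) (false ∷ v) eq inv =
  ⋖-invariant⇒constant (f ∘ (false ∷_)) u v eq (λ e → inv e ∘ keep)
⋖-invariant⇒constant f (true  ∷ u) (true  ∷ v) eq inv =
  ⋖-invariant⇒constant (f ∘ (true ∷_)) u v (ℕ.suc-injective eq)
    (λ e → inv (cong suc e) ∘ keep)
-- Here `u` has one more one than `v`; lowering a bit of it gives `u′`, of the weight of `v`. The
-- vector `true ∷ u` covers both `false ∷ u` and `true ∷ u′`.
⋖-invariant⇒constant f (false ∷ u) (true  ∷ v) eq inv
  with u′ , u′⋖u , eq′ ← ∃-⋖ u eq = begin
  f (false ∷ u)  ≡⟨ inv refl raise ⟩
  f (true ∷ u)   ≡⟨ inv (sym (⋖-weight u′⋖u)) (keep u′⋖u) ⟨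
  f (true ∷ u′)  ≡⟨ ⋖-invariant⇒constant (f ∘ (true ∷_)) u′ v eq′
                      (λ e → inv (trans (cong suc e) (sym (⋖-weight u′⋖u))) ∘ keep) ⟩
  f (true ∷ v)   ∎
  where open ≡-Reasoning
⋖-invariant⇒constant f (true  ∷ u) (false ∷ v) eq inv
  with v′ , v′⋖v , eq′ ← ∃-⋖ v (sym eq) = begin
  f (true ∷ u)   ≡⟨ ⋖-invariant⇒constant (f ∘ (true ∷_)) u v′ (sym eq′)
                      (λ e → inv (cong suc e) ∘ keep) ⟩
  f (true ∷ v′)  ≡⟨ inv (cong suc eq′) (keep v′⋖v) ⟩
  f (true ∷ v)   ≡⟨ inv (sym eq) raise ⟨
  f (false ∷ v)  ∎
  where open ≡-Reasoning

weight-replicate-false : ∀ n → weight (lookup (replicate n false)) ≡ 0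
weight-replicate-false zero    = refl
weight-replicate-false (suc n) = weight-replicate-false n

weight-replicate-true : ∀ n → weight (lookup (replicate n true)) ≡ n
weight-replicate-true zero    = refl
weight-replicate-true (suc n) = cong suc (weight-replicate-true n)

weight≤n : (x : Vector Bool n) → weight x ≤ n
weight≤n {n} x = subst (weight x ≤_) (weight-replicate-true n)
  (weight-mono λ p → subst (x p Bool.≤_) (sym (lookup-replicate p true)) (Bool.≤-maximum _))

∷-mono-⊑ : ∀ b {u v : Vec Bool n} → lookup u ⊑ lookup v → lookup (b ∷ u) ⊑ lookup (b ∷ v)
∷-mono-⊑ b u⊑v zero    = b≤b
∷-mono-⊑ b u⊑v (suc p) = u⊑v p

-- Bits of `x` are kept from the left until the rest must be all false or all true; a constant tail
-- is comparable with any tail.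
∃-comparable-of-weight :
  ∀ {n} (x : Vec Bool n) {w} → w ≤ n →
  ∃ λ v → weight (lookup v) ≡ w × (lookup x ⊑ lookup v ⊎ lookup v ⊑ lookup x)
∃-comparable-of-weight {n} x {zero} _ =
  replicate n false , weight-replicate-false n ,
  inj₂ λ p → subst (Bool._≤ lookup x p) (sym (lookup-replicate p false)) (Bool.≤-minimum _)
∃-comparable-of-weight (true ∷ x) {suc w} (s≤s w≤n)
  with ∃-comparable-of-weight x w≤n
... | v , eq , inj₁ x⊑v = true ∷ v , cong suc eq , inj₁ (∷-mono-⊑ true x⊑v)
... | v , eq , inj₂ v⊑x = true ∷ v , cong suc eq , inj₂ (∷-mono-⊑ true v⊑x)
∃-comparable-of-weight {suc n} (false ∷ x) {suc w} w<n with ℕ.m≤n⇒m<n∨m≡n w<n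
... | inj₂ refl =
  replicate (suc n) true , weight-replicate-true (suc n) ,
  inj₁ λ p → subst (lookup (false ∷ x) p Bool.≤_) (sym (lookup-replicate p true)) (Bool.≤-maximum _)
... | inj₁ (s≤s w≤n) with ∃-comparable-of-weight x w≤n
...   | v , eq , inj₁ x⊑v = false ∷ v , eq , inj₁ (∷-mono-⊑ false x⊑v)
...   | v , eq , inj₂ v⊑x = false ∷ v , eq , inj₂ (∷-mono-⊑ false v⊑x)

-- Sorted inputs

-- `above m` and `from m` are the sorted vectors of two consecutive weights; they differ only at
-- `m`, the channel that the mask will hide.
above : Fin n → Vec Bool n
above {suc n} zero    = false ∷ replicate n true
above         (suc m) = false ∷ above m

from : Fin n → Vec Bool n
from {suc n} zero    = replicate (suc n) true
from         (suc m) = false ∷ from m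

above⋖from : (m : Fin n) → above m ⋖ from m
above⋖from zero    = raise
above⋖from (suc m) = keep (above⋖from m)

lookup-above-≤ : {m p : Fin n} → p Fin.≤ m → lookup (above m) p ≡ false
lookup-above-≤ {m = zero}  {zero}  _   = refl
lookup-above-≤ {m = suc m} {zero}  _   = refl
lookup-above-≤ {m = suc m} {suc p} p≤m = lookup-above-≤ (s≤s⁻¹ p≤m)

lookup-above-> : {m p : Fin n} → m Fin.< p → lookup (above m) p ≡ true
lookup-above-> {m = zero}  {suc p} _   = lookup-replicate p true
lookup-above-> {m = suc m} {suc p} m<p = lookup-above-> (s≤s⁻¹ m<p)

lookup-above-≢ : {m p : Fin n} → p ≢ m → lookup (above m) p ≡ lookup (from m) p
lookup-above-≢ {m = zero}  {zero}  p≢m = contradiction refl p≢m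
lookup-above-≢ {m = zero}  {suc p} p≢m = refl
lookup-above-≢ {m = suc m} {zero}  p≢m = refl
lookup-above-≢ {m = suc m} {suc p} p≢m = lookup-above-≢ (p≢m ∘ cong suc)

lookup-from-< : {m p : Fin n} → p Fin.< m → lookup (from m) p ≡ false
lookup-from-< p<m =
  trans (sym (lookup-above-≢ (Fin.<⇒≢ p<m))) (lookup-above-≤ (ℕ.<⇒≤ p<m))

above-sorted : (m : Fin n) → IsSorted (lookup (above m))
above-sorted m {p} {q} p≤q with q Fin.≤? m
... | yes q≤m = Bool.≤-reflexive
  (trans (lookup-above-≤ (ℕ.≤-trans p≤q q≤m)) (sym (lookup-above-≤ q≤m)))
... | no  q≰m = subst (_ Bool.≤_) (sym (lookup-above-> (ℕ.≰⇒> q≰m))) (Bool.≤-maximum _)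

sorted∧false⇒⊑above : {y : Vector Bool n} {m : Fin n} → IsSorted y → y m ≡ false →
                      y ⊑ lookup (above m)
sorted∧false⇒⊑above {y = y} {m} sorted ym p with p Fin.≤? m
... | yes p≤m = subst₂ Bool._≤_ refl (trans ym (sym (lookup-above-≤ p≤m))) (sorted p≤m)
... | no  p≰m = subst (y p Bool.≤_) (sym (lookup-above-> (ℕ.≰⇒> p≰m))) (Bool.≤-maximum _)

sorted∧true⇒from⊑ : {y : Vector Bool n} {m : Fin n} → IsSorted y → y m ≡ true →
                    lookup (from m) ⊑ y
sorted∧true⇒from⊑ {y = y} {m} sorted ym p with m Fin.≤? p
... | yes m≤p = Bool.≤-trans (Bool.≤-maximum _) (subst (Bool._≤ y p) ym (sorted m≤p))
... | no  m≰p = subst (Bool._≤ y p) (sym (lookup-from-< (ℕ.≰⇒> m≰p))) (Bool.≤-minimum _)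

-- The value at `m` decides: if it is false, `y` lies below `above m` and equal weights force
-- equality; if it is true, `y` lies above `from m` and is too heavy.
sorted⇒above : {y : Vector Bool n} (m : Fin n) → IsSorted y →
               weight y ≡ weight (lookup (above m)) → y ≗ lookup (above m)
sorted⇒above {y = y} m sorted eq with y m in ym
... | false = ⊑∧weight≥⇒≗ (sorted∧false⇒⊑above sorted ym) (ℕ.≤-reflexive (sym eq))
... | true  = contradiction
  (subst₂ _≤_ (⋖-weight (above⋖from m)) eq (weight-mono (sorted∧true⇒from⊑ sorted ym)))
  ℕ.1+n≰n

sorted⇒from : {y : Vector Bool n} (m : Fin n) → IsSorted y →
              weight y ≡ weight (lookup (from m)) → y ≗ lookup (from m)
sorted⇒from {y = y} m sorted eq with y m in ym
... | true  = sym ∘ ⊑∧weight≥⇒≗ (sorted∧true⇒from⊑ sorted ym) (ℕ.≤-reflexive eq)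
... | false = contradiction
  (subst (_≤ weight (lookup (above m))) (trans eq (⋖-weight (above⋖from m)))
    (weight-mono (sorted∧false⇒⊑above sorted ym)))
  ℕ.1+n≰n

-- The counting core, free of networks. `f` will be the state with the comparator left out, `g` the
-- output, and `χ` the indicator of the channels outside the block of `m`.
separated⇒ordered :
  ∀ (f g : Vec Bool n → Vector Bool n) (χ : Vector Bool n) {i m j} →
  (∀ {u v} → lookup u ⊑ lookup v → f u ⊑ f v) →
  (∀ v → IsSorted (g v)) →
  (∀ v → weight (g v) ≡ weight (lookup v)) →
  (∀ v → weight (χ ⊓ f v) ≡ weight (χ ⊓ g v)) →
  f (above m) ≗ lookup (above m) →
  i Fin.< m → m Fin.< j → χ i ≡ true → χ j ≡ true → χ m ≡ false →
  ∀ x → f x i Bool.≤ f x j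
separated⇒ordered f g χ {i} {m} {j} f-mono g-sorted g-weight f~g f-above i<m m<j χi χj χm x
  = compare (∃-comparable-of-weight x (weight≤n (lookup (above m))))
  where
  outputs-agree : ∀ {u v} → weight (lookup u) ≡ weight (lookup (above m)) → u ⋖ v →
                  χ ⊓ g u ≗ χ ⊓ g v
  outputs-agree {u} {v} eq u⋖v p with p Fin.≟ m
  -- The outputs do differ at `m`, but the mask is false there.
  ... | yes refl rewrite χm = refl
  ... | no  p≢m  = cong (χ p ∧_) (begin
    g u p               ≡⟨ sorted⇒above m (g-sorted u) (trans (g-weight u) eq) p ⟩
    lookup (above m) p  ≡⟨ lookup-above-≢ p≢m ⟩
    lookup (from m) p   ≡⟨ sorted⇒from m (g-sorted v) weight-gv p ⟨
    g v p               ∎)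
    where
    open ≡-Reasoning
    weight-gv : weight (g v) ≡ weight (lookup (from m))
    weight-gv = begin
      weight (g v)                    ≡⟨ g-weight v ⟩
      weight (lookup v)               ≡⟨ ⋖-weight u⋖v ⟩
      suc (weight (lookup u))         ≡⟨ cong suc eq ⟩
      suc (weight (lookup (above m))) ≡⟨ ⋖-weight (above⋖from m) ⟨
      weight (lookup (from m))        ∎

  step : ∀ {p u v} → χ p ≡ true → weight (lookup u) ≡ weight (lookup (above m)) → u ⋖ v →
         f u p ≡ f v p
  -- `f v` dominates `f u`, so equal masked weights leave no room for a change; the `subst` removes
  -- the mask at `p`.
  step {p} {u} {v} χp eq u⋖v = subst (λ b → b ∧ f u p ≡ b ∧ f v p) χp
    (⊑∧weight≥⇒≗ (⊓-monoʳ-⊑ χ (f-mono (⋖⇒⊑ u⋖v))) (ℕ.≤-reflexive same-weight) p)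
    where
    open ≡-Reasoning
    same-weight : weight (χ ⊓ f v) ≡ weight (χ ⊓ f u)
    same-weight = begin
      weight (χ ⊓ f v)  ≡⟨ f~g v ⟩
      weight (χ ⊓ g v)  ≡⟨ weight-cong (outputs-agree eq u⋖v) ⟨
      weight (χ ⊓ g u)  ≡⟨ f~g u ⟨
      weight (χ ⊓ f u)  ∎

  f≡above : ∀ {p v} → χ p ≡ true → weight (lookup v) ≡ weight (lookup (above m)) →
            f v p ≡ lookup (above m) p
  f≡above {p} {v} χp eq = trans
    (⋖-invariant⇒constant (λ u → f u p) v (above m) eq (λ e → step χp (trans e eq)))
    (f-above p)

  compare : (∃ λ v → weight (lookup v) ≡ weight (lookup (above m)) ×
                     (lookup x ⊑ lookup v ⊎ lookup v ⊑ lookup x)) →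
            f x i Bool.≤ f x j
  -- Below an input of the critical weight, channel `i` carries 0; above one, channel `j` carries 1.
  -- Either value settles the comparison.
  compare (v , eq , inj₁ x⊑v) = Bool.≤-trans
    (subst (f x i Bool.≤_) (trans (f≡above {v = v} χi eq) (lookup-above-≤ (ℕ.<⇒≤ i<m)))
      (f-mono {x} {v} x⊑v i))
    (Bool.≤-minimum _)
  compare (v , eq , inj₂ v⊑x) = Bool.≤-trans
    (Bool.≤-maximum _)
    (subst (Bool._≤ f x j) (trans (f≡above {v = v} χj eq) (lookup-above-> m<j))
      (f-mono {v} {x} v⊑x j))

-- Comparators and layers

∧-mono-≤ : ∀ {a b c d} → a Bool.≤ b → c Bool.≤ d → a ∧ c Bool.≤ b ∧ d
∧-mono-≤         f≤t c≤d = Bool.≤-minimum _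
∧-mono-≤ {false} b≤b c≤d = b≤b
∧-mono-≤ {true}  b≤b c≤d = c≤d

∨-mono-≤ : ∀ {a b c d} → a Bool.≤ b → c Bool.≤ d → a ∨ c Bool.≤ b ∨ d
∨-mono-≤         f≤t c≤d = Bool.≤-maximum _
∨-mono-≤ {false} b≤b c≤d = c≤d
∨-mono-≤ {true}  b≤b c≤d = b≤b

≤⇒∧≡ : ∀ {a b} → a Bool.≤ b → a ∧ b ≡ a
≤⇒∧≡ f≤t = refl
≤⇒∧≡ b≤b = Bool.∧-idem _

≤⇒∨≡ : ∀ {a b} → a Bool.≤ b → a ∨ b ≡ b
≤⇒∨≡ f≤t = refl
≤⇒∨≡ b≤b = Bool.∨-idem _

apply-mono : ∀ (cs : List (Comparator n)) {x y} → x ⊑ y →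
             applyComparators cs x ⊑ applyComparators cs y
apply-mono []       x⊑y p = x⊑y p
apply-mono (c ∷ cs) x⊑y p with p Fin.≟ lo c | p Fin.≟ hi c
... | yes _ | _     = ∧-mono-≤ (x⊑y _) (x⊑y _)
... | no _  | yes _ = ∨-mono-≤ (x⊑y _) (x⊑y _)
... | no _  | no _  = apply-mono cs x⊑y p

apply-ordered : {cs : List (Comparator n)} {x : Vector Bool n} →
                All (λ c → x (lo c) Bool.≤ x (hi c)) cs → applyComparators cs x ≗ x
apply-ordered []                            p = refl
apply-ordered {cs = c ∷ cs} (lo≤hi ∷ cs-ordered) p with p Fin.≟ lo c | p Fin.≟ hi c
... | yes refl | _        = ≤⇒∧≡ lo≤hi
... | no _     | yes refl = ≤⇒∨≡ lo≤hi
... | no _     | no _     = apply-ordered cs-ordered p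

apply-untouched : {cs : List (Comparator n)} (x : Vector Bool n) {p : Fin n} →
                  All (λ c → ¬ Touches c p) cs → applyComparators cs x p ≡ x p
apply-untouched                x     []                = refl
apply-untouched {cs = c ∷ cs} x {p} (¬c ∷ untouched) with p Fin.≟ lo c | p Fin.≟ hi c
... | yes p≡lo | _        = contradiction (inj₁ p≡lo) ¬c
... | no _     | yes p≡hi = contradiction (inj₂ p≡hi) ¬c
... | no _     | no _     = apply-untouched x untouched

-- By disjointness `cs` leaves the two channels of `c` alone, so `c` reads the same values before
-- and after it. This reduces layers to single comparators.
apply-sequential : ∀ {c : Comparator n} {cs} x → All (Disjoint c) cs →
                   applyComparators (c ∷ cs) x ≗ applyComparators (c ∷ []) (applyComparators cs x)
apply-sequential {c = c} {cs} x c#cs p = lemma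
  where
  unchanged : ∀ {q} → Touches c q → applyComparators cs x q ≡ x q
  unchanged t = apply-untouched x (All.map (λ c#c′ t′ → c#c′ _ (t , t′)) c#cs)

  lemma : applyComparators (c ∷ cs) x p ≡ applyComparators (c ∷ []) (applyComparators cs x) p
  lemma with p Fin.≟ lo c | p Fin.≟ hi c
  ... | yes _ | _     = sym (cong₂ _∧_ (unchanged (inj₁ refl)) (unchanged (inj₂ refl)))
  ... | no _  | yes _ = sym (cong₂ _∨_ (unchanged (inj₁ refl)) (unchanged (inj₂ refl)))
  ... | no _  | no _  = refl

apply-reversed : (c : Comparator n) (x : Vector Bool n) → x (hi c) Bool.≤ x (lo c) →
                 applyComparators (c ∷ []) x ≗ x ∘ (transpose (lo c) (hi c) ⟨$⟩ʳ_)
apply-reversed c x hi≤lo p with p Fin.≟ lo c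
... | yes refl = trans (Bool.∧-comm _ (x (hi c))) (≤⇒∧≡ hi≤lo)
... | no _ with p Fin.≟ hi c
...   | yes refl = trans (Bool.∨-comm (x (lo c)) _) (≤⇒∨≡ hi≤lo)
...   | no _     = refl

transpose-invariant : ∀ {A : Set} (f : Fin n → A) {i j} → f i ≡ f j →
                      ∀ p → f (transpose i j ⟨$⟩ʳ p) ≡ f p
transpose-invariant f {i} {j} fi≡fj p with p Fin.≟ i
... | yes refl = sym fi≡fj
... | no _ with p Fin.≟ j
...   | yes refl = fi≡fj
...   | no _     = refl

-- A comparator acts on a given input as the identity or as a transposition. The latter preserves
-- `χ` by hypothesis, and sums are invariant under permutation.
comparator-weight : ∀ (χ : Vector Bool n) c x → χ (lo c) ≡ χ (hi c) →
                    weight (χ ⊓ applyComparators (c ∷ []) x) ≡ weight (χ ⊓ x)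
comparator-weight χ c x χ≡ with Bool.≤-total (x (lo c)) (x (hi c))
... | inj₁ lo≤hi = weight-cong λ p → cong (χ p ∧_) (apply-ordered {cs = c ∷ []} (lo≤hi ∷ []) p)
... | inj₂ hi≤lo = begin
  weight (χ ⊓ applyComparators (c ∷ []) x)
    ≡⟨ weight-cong (λ p → cong₂ _∧_ (sym (transpose-invariant χ χ≡ p)) (apply-reversed c x hi≤lo p)) ⟩
  weight ((χ ⊓ x) ∘ (τ ⟨$⟩ʳ_))
    ≡⟨ sum-permute (bit ∘ (χ ⊓ x)) τ ⟨
  weight (χ ⊓ x) ∎
  where
  open ≡-Reasoning
  τ = transpose (lo c) (hi c)

apply-weight : ∀ (χ : Vector Bool n) {cs} x → AllPairs Disjoint cs →
               All (λ c → χ (lo c) ≡ χ (hi c)) cs →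
               weight (χ ⊓ applyComparators cs x) ≡ weight (χ ⊓ x)
apply-weight χ          x []           []           = refl
apply-weight χ {c ∷ cs} x (c#cs ∷ #cs) (χ≡ ∷ χ-cs) = begin
  weight (χ ⊓ applyComparators (c ∷ cs) x)
    ≡⟨ weight-cong (λ p → cong (χ p ∧_) (apply-sequential {c = c} x c#cs p)) ⟩
  weight (χ ⊓ applyComparators (c ∷ []) (applyComparators cs x))
    ≡⟨ comparator-weight χ c _ χ≡ ⟩
  weight (χ ⊓ applyComparators cs x)
    ≡⟨ apply-weight χ x #cs χ-cs ⟩
  weight (χ ⊓ x) ∎
  where open ≡-Reasoning

lo≢hi : (c : Comparator n) → lo c ≢ hi c
lo≢hi c = Fin.<⇒≢ (lo<hi c)

apply-∈ : ∀ {c : Comparator n} {cs} x → AllPairs Disjoint cs → c ∈ cs →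
          ∀ {p} → Touches c p →
          applyComparators cs x p ≡ applyComparators (c ∷ []) x p
apply-∈ {cs = c ∷ cs} x _ (here refl) {p} t with p Fin.≟ lo c | p Fin.≟ hi c
... | yes _    | _        = refl
... | no _     | yes _    = refl
... | no p≢lo  | no p≢hi  with t
...   | inj₁ p≡lo = contradiction p≡lo p≢lo
...   | inj₂ p≡hi = contradiction p≡hi p≢hi
apply-∈ {cs = c′ ∷ cs} x (c′#cs ∷ #cs) (there c∈cs) {p} t with p Fin.≟ lo c′ | p Fin.≟ hi c′
... | yes p≡lo | _        = contradiction (inj₁ p≡lo , t) (All.lookup c′#cs c∈cs p)
... | no _     | yes p≡hi = contradiction (inj₂ p≡hi , t) (All.lookup c′#cs c∈cs p)
... | no _     | no _     = apply-∈ x #cs c∈cs t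

-- When a layer containing c takes y to z, this is what that layer without c
-- makes of y.
undo : Comparator n → Vector Bool n → Vector Bool n → Vector Bool n
undo c y z p =
  if ⌊ p Fin.≟ lo c ⌋ then y (lo c)
  else if ⌊ p Fin.≟ hi c ⌋ then y (hi c)
  else z p

undo-lo : ∀ (c : Comparator n) y z → undo c y z (lo c) ≡ y (lo c)
undo-lo c y z with lo c Fin.≟ lo c
... | yes _    = refl
... | no lo≢lo = contradiction refl lo≢lo

undo-hi : ∀ (c : Comparator n) y z → undo c y z (hi c) ≡ y (hi c)
undo-hi c y z with hi c Fin.≟ lo c | hi c Fin.≟ hi c
... | yes hi≡lo | _        = contradiction (sym hi≡lo) (lo≢hi c)
... | no _      | yes _    = refl
... | no _      | no hi≢hi = contradiction refl hi≢hi

undo-mono : ∀ (c : Comparator n) {y y′ z z′} → y ⊑ y′ → z ⊑ z′ → undo c y z ⊑ undo c y′ z′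
undo-mono c y⊑y′ z⊑z′ p with p Fin.≟ lo c | p Fin.≟ hi c
... | yes _ | _     = y⊑y′ _
... | no _  | yes _ = y⊑y′ _
... | no _  | no _  = z⊑z′ p

undo-fixed : ∀ (c : Comparator n) {x y z} → y ≗ x → z ≗ x → undo c y z ≗ x
undo-fixed c y≗x z≗x p with p Fin.≟ lo c | p Fin.≟ hi c
... | yes refl | _        = y≗x _
... | no _     | yes refl = y≗x _
... | no _     | no _     = z≗x p

-- On the channels of `c` the layer acts as `c` alone; elsewhere `undo` changes nothing. Thus the
-- layer is its remainder followed by `c`.
apply-undo : ∀ {c : Comparator n} {cs} y → AllPairs Disjoint cs → c ∈ cs →
             applyComparators (c ∷ []) (undo c y (applyComparators cs y)) ≗ applyComparators cs y
apply-undo {c = c} {cs} y #cs c∈cs p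
  rewrite undo-lo c y (applyComparators cs y) | undo-hi c y (applyComparators cs y)
  with p Fin.≟ lo c | p Fin.≟ hi c | apply-∈ y #cs c∈cs {p}
... | yes p≡lo | _        | z≡ = sym (z≡ (inj₁ p≡lo))
... | no _     | yes p≡hi | z≡ = sym (z≡ (inj₂ p≡hi))
... | no _     | no _     | _  = refl

-- Networks

after-mono : ∀ (C : Network n d) k {x y} → x ⊑ y → after C k x ⊑ after C k y
after-mono C       zero    x⊑y = x⊑y
after-mono []      (suc k) x⊑y = x⊑y
after-mono (L ∷ C) (suc k) x⊑y = after-mono C k (apply-mono (comparators L) x⊑y)

after-sorted : ∀ (C : Network n d) k {x} → IsSorted x → after C k x ≗ x
after-sorted C       zero    sorted p = refl
after-sorted []      (suc k) sorted p = refl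
after-sorted (L ∷ C) (suc k) {x} sorted p = trans (after-sorted C k sorted′ p) (fixed p)
  where
  fixed : applyLayer L x ≗ x
  fixed = apply-ordered (All.universal (λ c → sorted (ℕ.<⇒≤ (lo<hi c))) (comparators L))
  sorted′ : IsSorted (applyLayer L x)
  sorted′ {p} {q} p≤q = subst₂ Bool._≤_ (sym (fixed p)) (sym (fixed q)) (sorted p≤q)

after-suc : ∀ (C : Network n d) ℓ x →
            after C (suc (toℕ ℓ)) x ≡ applyLayer (lookup C ℓ) (after C (toℕ ℓ) x)
after-suc (L ∷ C) zero    x = refl
after-suc (L ∷ C) (suc ℓ) x = after-suc C ℓ (applyLayer L x)

-- Layers are numbered from 1, so dropping the first `k` leaves exactly those numbered above `k`,
-- which define the `k`-blocks.
laterComparators : Network n d → ℕ → List (Comparator n)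
laterComparators []      k       = []
laterComparators (L ∷ C) zero    = comparators L ++ laterComparators C zero
laterComparators (L ∷ C) (suc k) = laterComparators C k

later⇒InLayer : ∀ (C : Network n d) k {c} → c ∈ laterComparators C k →
                ∃ λ k′ → k < k′ × InLayer C k′ c
later⇒InLayer (L ∷ C) zero c∈ with ∈-++⁻ (comparators L) c∈
... | inj₁ c∈L = 1 , s≤s z≤n , zero , refl , c∈L
... | inj₂ c∈C with _ , _ , ℓ , refl , c∈ℓ ← later⇒InLayer C zero c∈C =
  _ , s≤s z≤n , suc ℓ , refl , c∈ℓ
later⇒InLayer (L ∷ C) (suc k) c∈ with _ , k<k′ , ℓ , refl , c∈ℓ ← later⇒InLayer C k c∈ =
  _ , s≤s k<k′ , suc ℓ , refl , c∈ℓ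

-- No later comparator joins the set marked by `χ` to its complement, so each later layer keeps the
-- number of ones in it.
output-weight : ∀ (χ : Vector Bool n) (C : Network n d) k x →
                (∀ {c} → c ∈ laterComparators C k → χ (lo c) ≡ χ (hi c)) →
                weight (χ ⊓ output C x) ≡ weight (χ ⊓ after C k x)
output-weight χ []      zero    x χ-inv = refl
output-weight χ []      (suc k) x χ-inv = refl
output-weight χ (L ∷ C) zero    x χ-inv = trans
  (output-weight χ C zero (applyLayer L x) (χ-inv ∘ ∈-++⁺ʳ (comparators L)))
  (apply-weight χ x (disjoint L) (All.tabulate (χ-inv ∘ ∈-++⁺ˡ)))
output-weight χ (L ∷ C) (suc k) x χ-inv = output-weight χ C k (applyLayer L x) χ-inv

-- Blocks

merge : Fin n → Fin n → Fin n → Fin n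
merge a b l = if ⌊ l Fin.≟ a ⌋ then b else l

merge-left : ∀ (a b : Fin n) → merge a b a ≡ b
merge-left a b with a Fin.≟ a
... | yes _  = refl
... | no a≢a = contradiction refl a≢a

merge-right : ∀ (a b : Fin n) → merge a b b ≡ b
merge-right a b with b Fin.≟ a
... | yes _ = refl
... | no _  = refl

-- A union-find labelling: adding `c` renames the label of `lo c` to that of `hi c`. Membership in a
-- block becomes a decidable test on labels.
component : List (Comparator n) → Fin n → Fin n
component []       p = p
component (c ∷ cs) p =
  merge (component cs (lo c)) (component cs (hi c)) (component cs p)

component-∈ : ∀ {c : Comparator n} {cs} → c ∈ cs →
              component cs (lo c) ≡ component cs (hi c)
component-∈ {c = c} {_ ∷ cs} (here refl) =
  trans (merge-left a b) (sym (merge-right a b))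
  where
  a = component cs (lo c)
  b = component cs (hi c)
component-∈ {cs = c ∷ cs} (there c∈cs) =
  cong (merge (component cs (lo c)) (component cs (hi c))) (component-∈ c∈cs)

-- If two labels become equal only through the renaming for `c`, one channel was connected to `lo c`
-- and the other to `hi c`, and the edge of `c` joins them.
component-≡⇒EqClosure :
  ∀ {R : Rel (Fin n) 0ℓ} {cs} → All (λ c → R (lo c) (hi c)) cs →
  ∀ {p q} → component cs p ≡ component cs q → EqClosure R p q
component-≡⇒EqClosure [] refl = ε
component-≡⇒EqClosure {R = R} {c ∷ cs} (r ∷ rs) {p} {q} eq
  with component cs p Fin.≟ component cs (lo c) | component cs q Fin.≟ component cs (lo c)
... | yes p~lo | yes q~lo = component-≡⇒EqClosure rs (trans p~lo (sym q~lo))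
... | yes p~lo | no _     =
  component-≡⇒EqClosure rs p~lo ◅◅ return r ◅◅ component-≡⇒EqClosure rs eq
... | no _     | yes q~lo =
  component-≡⇒EqClosure rs eq ◅◅ symmetric R (return r) ◅◅ component-≡⇒EqClosure rs (sym q~lo)
... | no _     | no _     = component-≡⇒EqClosure rs eq

-- Redundancy of a comparator that misses the block of a channel between its ends

theorem2 : ∀ (n d : ℕ) (C : Network n d) →
    IsSortingNetwork C → NoRedundantComparators C →
    ∀ k → 1 ≤ k → k < d →
    ∀ c → InLayer C k c → ConnectsAdjacentBlocks C k c
theorem2 n d C sorting irredundant k _ _ c c∈k@(ℓ , refl , c∈ℓ) m lo<m m<hi
  = decide (label (lo c) Fin.≟ label m) (label (hi c) Fin.≟ label m)
  where
  later = laterComparators C k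
  label = component later

  sameBlock : ∀ {p q} → label p ≡ label q → Block C k p q
  sameBlock = component-≡⇒EqClosure (All.tabulate λ {c′} c′∈ →
    let k′ , k<k′ , c′∈k′ = later⇒InLayer C k c′∈ in k′ , k<k′ , c′ , c′∈k′ , refl , refl)

  χ : Vector Bool n
  χ p = not ⌊ label p Fin.≟ label m ⌋

  χ-outside : ∀ {p} → label p ≢ label m → χ p ≡ true
  χ-outside {p} p≁m with label p Fin.≟ label m
  ... | yes p~m = contradiction p~m p≁m
  ... | no _    = refl

  χ-m : χ m ≡ false
  χ-m with label m Fin.≟ label m
  ... | yes _  = refl
  ... | no m≁m = contradiction refl m≁m

  before f g : Vec Bool n → Vector Bool n
  -- Since `k` is `suc (toℕ ℓ)`, this is the state entering layer `k`, the one that redundancy of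
  -- `c` speaks about.
  before v = after C (toℕ ℓ) (lookup v)
  f v      = undo c (before v) (after C k (lookup v))
  g v      = output C (lookup v)

  redo : ∀ v → applyComparators (c ∷ []) (f v) ≗ after C k (lookup v)
  redo v rewrite after-suc C ℓ (lookup v) =
    apply-undo (before v) (disjoint (lookup C ℓ)) c∈ℓ

  module _ (lo≁m : label (lo c) ≢ label m) (hi≁m : label (hi c) ≢ label m) where
    open ≡-Reasoning

    f~g : ∀ v → weight (χ ⊓ f v) ≡ weight (χ ⊓ g v)
    f~g v = begin
      weight (χ ⊓ f v)
        ≡⟨ comparator-weight χ c (f v) (trans (χ-outside lo≁m) (sym (χ-outside hi≁m))) ⟨
      weight (χ ⊓ applyComparators (c ∷ []) (f v))
        ≡⟨ weight-cong (λ p → cong (χ p ∧_) (redo v p)) ⟩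
      weight (χ ⊓ after C k (lookup v))
        -- Both ends of a later comparator have the same label, so `χ` agrees on them.
        ≡⟨ output-weight χ C k (lookup v)
             (λ c′∈ → cong (λ l → not ⌊ l Fin.≟ label m ⌋) (component-∈ c′∈)) ⟨
      weight (χ ⊓ g v) ∎

    f-ordered : ∀ v → f v (lo c) Bool.≤ f v (hi c)
    f-ordered = separated⇒ordered f g χ
      (λ u⊑v → undo-mono c (after-mono C (toℕ ℓ) u⊑v) (after-mono C k u⊑v))
      (λ v → sorting (lookup v))
      -- With the all-true mask and no layer skipped, this says that the network preserves total
      -- weight.
      (λ v → output-weight (λ _ → true) C 0 (lookup v) (λ _ → refl))
      f~g
      (undo-fixed c (after-sorted C (toℕ ℓ) (above-sorted m)) (after-sorted C k (above-sorted m)))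
      lo<m m<hi (χ-outside lo≁m) (χ-outside hi≁m) χ-m

    redundant : Redundant C k c
    -- `undo` restores the values before layer `k` at both ends of `c`, so `f-ordered` concerns the
    -- right state. As `x` and `lookup v` agree only pointwise, monotonicity transfers the
    -- inequality.
    redundant x = Bool.≤-trans (after-mono C (toℕ ℓ) x⊑v (lo c))
      (Bool.≤-trans
        (subst₂ Bool._≤_ (undo-lo c y z) (undo-hi c y z) (f-ordered v))
        (after-mono C (toℕ ℓ) v⊑x (hi c)))
      where
      v = tabulate x
      y = before v
      z = after C k (lookup v)
      x⊑v : x ⊑ lookup v
      x⊑v p = Bool.≤-reflexive (sym (lookup∘tabulate x p))
      v⊑x : lookup v ⊑ x
      v⊑x p = Bool.≤-reflexive (lookup∘tabulate x p)

  decide : Dec (label (lo c) ≡ label m) → Dec (label (hi c) ≡ label m) →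
           Block C k (lo c) m ⊎ Block C k (hi c) m
  decide (yes lo~m) _          = inj₁ (sameBlock lo~m)
  decide (no _)     (yes hi~m) = inj₂ (sameBlock hi~m)
  decide (no lo≁m)  (no hi≁m)  = contradiction (redundant lo≁m hi≁m) (irredundant k c c∈k)
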